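{- For all integers $n\ge 2$, $$F_{n}^2=F_{n-1}^2+3F_{n-2}^2+2\sum_{i=3}^nF_{n-i}^2 .$$
   Context: The Fibonacci numbers are $F_0=0$, $F_1=1$, $F_n=F_{n-1}+F_{n-2}$ for $n\ge2$. Empty sums are $0$. -}

module Defs where

open import Data.Nat using (ℕ; zero; suc; _+_; _∸_)
open import Data.List using (map; upTo)
open import Data.Nat.ListAction using (sum)

F : ℕ → ℕ
F zero          = 0
F (suc zero)    = 1
F (suc (suc n)) = F (suc n) + F n

-- f a + f (a + 1) + ⋯ + f b, with both endpoints included. There are
-- suc b ∸ a terms, so the sum is empty (equal to 0) when b < a.
sumFromTo : ℕ → ℕ → (ℕ → ℕ) → ℕ
sumFromTo a b f = sum (map (λ k → f (a + k)) (upTo (suc b ∸ a)))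

infix 5 sumFromTo
syntax sumFromTo a b (λ i → e) = Σ[ i from a to b ] e

{-# OPTIONS --safe #-}
-- Since F₀² + ⋯ + Fₚ² = Fₚ Fₚ₊₁, writing a = Fₚ and b = Fₚ₊₁ with n = p + 3
-- turns the claim into (2b + a)² = (b + a)² + 3b² + 2ab.
module Submission where

open import Defs
open import Data.List using (map; upTo)
open import Data.List.Properties using (map-applyUpTo; map-upTo)
open import Data.Nat using (ℕ; zero; suc; _+_; _*_; _∸_; _^_; _≤_; z≤n; s≤s)
open import Data.Nat.ListAction using (sum)
open import Data.Nat.Tactic.RingSolver using (solve-∀)
open import Relation.Binary.PropositionalEquality
  using (_≡_; refl; sym; trans; cong; module ≡-Reasoning)

open ≡-Reasoning

-- For `n = p + 3` the sum is Fₚ² + ⋯ + F₀², which telescopes to Fₚ Fₚ₊₁ by induction on `p`; a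
-- polynomial identity remains.

sumDown : (ℕ → ℕ) → ℕ → ℕ
sumDown g m = sum (map (λ k → g (m ∸ suc k)) (upTo m))

-- The index 0 gives `g m`; the shifted tail agrees with `sumDown g m` since both normalise to the
-- same `applyUpTo`.
sumDown-suc : ∀ g m → sumDown g (suc m) ≡ g m + sumDown g m
sumDown-suc g m = cong (λ xs → g m + sum xs)
  (trans (map-applyUpTo suc (λ k → g (m ∸ k)) m)
         (sym (map-upTo (λ k → g (m ∸ suc k)) m)))

sum-of-squares : ∀ p → sumDown (λ i → F i ^ 2) (suc p) ≡ F p * F (suc p)
sum-of-squares zero    = refl
sum-of-squares (suc p) = begin
  sumDown sq (suc (suc p))           ≡⟨ sumDown-suc sq (suc p) ⟩
  F (suc p) ^ 2 + sumDown sq (suc p) ≡⟨ cong (F (suc p) ^ 2 +_) (sum-of-squares p) ⟩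
  F (suc p) ^ 2 + F p * F (suc p)    ≡⟨ factor (F p) (F (suc p)) ⟩
  F (suc p) * F (suc (suc p))        ∎
  where
  sq : ℕ → ℕ
  sq i = F i ^ 2

  -- x ^ 2 is unfolded to x * (x * 1), as solve-∀ rejects literal exponents.
  factor : ∀ a b → b * (b * 1) + a * b ≡ b * (b + a)
  factor = solve-∀

square-expansion : ∀ a b →
  ((b + a) + b) * (((b + a) + b) * 1) ≡
    (b + a) * ((b + a) * 1) + 3 * (b * (b * 1)) + 2 * (a * b)
square-expansion = solve-∀

mainTheorem2 : (n : ℕ) → 2 ≤ n →
    F n ^ 2 ≡ F (n ∸ 1) ^ 2 + 3 * F (n ∸ 2) ^ 2 + 2 * (Σ[ i from 3 to n ] (F (n ∸ i) ^ 2))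
-- Here the sum is empty.
mainTheorem2 (suc (suc zero))    (s≤s (s≤s z≤n)) = refl
mainTheorem2 (suc (suc (suc p))) (s≤s (s≤s z≤n)) =
  trans (square-expansion (F p) (F (suc p)))
        -- `n ∸ (3 + k)` computes to `p ∸ k`, so the sum is definitionally a `sumDown` of length
        -- `suc p`.
        (cong (λ s → F (2 + p) ^ 2 + 3 * F (1 + p) ^ 2 + 2 * s) (sym (sum-of-squares p)))
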